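{- Let $d\geq 1$ and let $\varphi$ be a partial $d$-edge coloring of $Q_d$. Let $a(d)$ and $b(d)$ be functions satisfying $\frac{109}{1776}d^2 - 2b(d)\left(a(d)-\frac{7d}{8}\right)\geq 0$ and $a(d)\geq b(d)$. (i) If every color appears on at most $d/8$ edges under $\varphi$, every edge of $Q_d$ is parallel to at most $b(d)$ other $\varphi$-colored edges, and every dimensional matching of $Q_d$ contains at most $a(d)$ $\varphi$-colored edges, then $\varphi$ is avoidable. (ii) For every constant $C_1\geq 1$, setting $C_2 = 2C_1(C_1+2)\cdot 34^2$, if every dimensional matching of $Q_d$ contains at most $C_1 d$ $\varphi$-colored edges and every color appears on at most $d/C_2$ edges under $\varphi$, then $\varphi$ is avoidable.
   Context: $Q_d$ is the $d$-dimensional hypercube (vertex set $\{0,1\}^d$, two vertices adjacent iff they differ in exactly one coordinate). For $i=1,\dots,d$, the $i$-th dimensional matching of $Q_d$ is the perfect matching consisting of all edges whose endpoints differ in coordinate $i$. Two edges of $Q_d$ are parallel if they are non-adjacent and lie on a common $4$-cycle. A partial $d$-edge coloring of $Q_d$ assigns colors from $\{1,\dots,d\}$ to some subset of edges (not necessarily properly); it is avoidable if there is a proper $d$-edge coloring $f$ of $Q_d$ with colors $1,\dots,d$ such that $f(e)\neq\varphi(e)$ for every $\varphi$-colored edge $e$.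
   Formalization: The values a(d), b(d) and the constant C₁ are taken to be rational numbers instead of real numbers. -}

module Defs where

open import Data.Bool using (Bool; true; false; not)
open import Data.Nat as ℕ using (ℕ)
open import Data.Fin using (Fin)
open import Data.Vec using (Vec; lookup; _[_]≔_)
open import Data.Maybe using (Maybe; just)
open import Data.List using (List; length)
open import Data.List.Relation.Unary.All using (All)
open import Data.List.Relation.Unary.Unique.Propositional using (Unique)
open import Data.Integer using (+_)
open import Data.Rational using (ℚ; _/_; _≤_; _<_; _+_; _*_; _÷_; 0ℚ; 1ℚ; Positive; NonZero; positive)
open import Data.Rational.Properties using (<-≤-trans; pos*pos⇒pos; pos+pos⇒pos; pos⇒nonZero)
open import Data.Product using (Σ; ∃; _×_; _,_)
open import Data.Sum using (_⊎_)
open import Relation.Binary.PropositionalEquality using (_≡_; _≢_)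
open import Relation.Nullary using (¬_)

ℕ→ℚ : ℕ → ℚ
ℕ→ℚ n = + n / 1

Vertex : ℕ → Set
Vertex d = Vec Bool d

AdjacentV : ∀ {d} → Vertex d → Vertex d → Set
AdjacentV {d} u w = ∃ λ (i : Fin d) → w ≡ (u [ i ]≔ not (lookup u i))

-- an edge of Q_d, represented canonically by its endpoint with a 0 in
-- coordinate dir; the other endpoint is obtained by setting that coordinate to 1
record Edge (d : ℕ) : Set where
  constructor edge
  field
    base : Vertex d
    dir  : Fin d
    low  : lookup base dir ≡ false

  top : Vertex d
  top = base [ dir ]≔ true

open Edge public

Endpoint : ∀ {d} → Vertex d → Edge d → Set
Endpoint v e = (v ≡ base e) ⊎ (v ≡ top e)

ShareEndpoint : ∀ {d} → Edge d → Edge d → Set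
ShareEndpoint {d} e e' = ∃ λ (v : Vertex d) → Endpoint v e × Endpoint v e'

AdjacentE : ∀ {d} → Edge d → Edge d → Set
AdjacentE e e' = e ≢ e' × ShareEndpoint e e'

Joins : ∀ {d} → Edge d → Vertex d → Vertex d → Set
Joins e x y = (base e ≡ x × top e ≡ y) ⊎ (base e ≡ y × top e ≡ x)

record FourCycle (d : ℕ) : Set where
  field
    v0 v1 v2 v3 : Vertex d
    d01 : v0 ≢ v1
    d02 : v0 ≢ v2
    d03 : v0 ≢ v3
    d12 : v1 ≢ v2
    d13 : v1 ≢ v3
    d23 : v2 ≢ v3
    a01 : AdjacentV v0 v1
    a12 : AdjacentV v1 v2
    a23 : AdjacentV v2 v3
    a30 : AdjacentV v3 v0

OnCycle : ∀ {d} → Edge d → FourCycle d → Set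
OnCycle e C = Joins e v0 v1 ⊎ Joins e v1 v2 ⊎ Joins e v2 v3 ⊎ Joins e v3 v0
  where open FourCycle C

Parallel : ∀ {d} → Edge d → Edge d → Set
Parallel {d} e e' =
  ¬ ShareEndpoint e e' × (∃ λ (C : FourCycle d) → OnCycle e C × OnCycle e' C)

-- partial d-edge coloring (colors 1..d represented by Fin d); nothing = uncolored
PartialColoring : ℕ → Set
PartialColoring d = Edge d → Maybe (Fin d)

Colored : ∀ {d} → PartialColoring d → Edge d → Set
Colored {d} φ e = ∃ λ (c : Fin d) → φ e ≡ just c

ProperColoring : ∀ {d} → (Edge d → Fin d) → Set
ProperColoring {d} f = (e e' : Edge d) → AdjacentE e e' → f e ≢ f e'

Avoidable : ∀ {d} → PartialColoring d → Set
Avoidable {d} φ =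
  Σ (Edge d → Fin d) λ f →
    ProperColoring f × ((e : Edge d) (c : Fin d) → φ e ≡ just c → f e ≢ c)

AtMost : ∀ {d} → (Edge d → Set) → ℚ → Set
AtMost {d} P k = (xs : List (Edge d)) → Unique xs → All P xs → ℕ→ℚ (length xs) ≤ k

C₂ : ℚ → ℚ
C₂ C₁ = ℕ→ℚ 2 * C₁ * (C₁ + ℕ→ℚ 2) * ℕ→ℚ (34 ℕ.* 34)

C₂-pos : (C₁ : ℚ) → 1ℚ ≤ C₁ → Positive (C₂ C₁)
C₂-pos C₁ h = p4
  where
  instance
    pC : Positive C₁
    pC = positive (<-≤-trans (Data.Rational.Properties.positive⁻¹ 1ℚ) h)
    p2 : Positive (ℕ→ℚ 2)
    p2 = _
    p1 : Positive (ℕ→ℚ 2 * C₁)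
    p1 = pos*pos⇒pos (ℕ→ℚ 2) C₁
    p3 : Positive (C₁ + ℕ→ℚ 2)
    p3 = pos+pos⇒pos C₁ (ℕ→ℚ 2)
    p12 : Positive (ℕ→ℚ 2 * C₁ * (C₁ + ℕ→ℚ 2))
    p12 = pos*pos⇒pos (ℕ→ℚ 2 * C₁) (C₁ + ℕ→ℚ 2)
    p34 : Positive (ℕ→ℚ (34 ℕ.* 34))
    p34 = _
  p4 : Positive (C₂ C₁)
  p4 = pos*pos⇒pos (ℕ→ℚ 2 * C₁ * (C₁ + ℕ→ℚ 2)) (ℕ→ℚ (34 ℕ.* 34))

d/C₂ : ℕ → (C₁ : ℚ) → 1ℚ ≤ C₁ → ℚ
d/C₂ d C₁ h = _÷_ (ℕ→ℚ d) (C₂ C₁) {{pos⇒nonZero (C₂ C₁) {{C₂-pos C₁ h}}}}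

{-# OPTIONS --safe #-}
-- Both parts reduce to color classes of size at most d/8 (in part (ii), C₂ ≥ 8).
-- Color every edge e by π (dir e) for a permutation π of the colors; e is a
-- conflict if φ e is that color.  Conflicts are repaired by exchanging the two
-- colors on pairwise edge-disjoint 4-cycles, one through each conflict.  Put
-- m = ⌊d/8⌋, let X be the number of conflicts and Y the number of pairs (e , j)
-- such that e is a conflict and the edge opposite to e in direction j has
-- φ-color π j.  There are at most d m colored edges, and averaging over all π
-- gives E X ≤ m and E Y ≤ d m (d − 1) / (d (d − 1)) = m, so some π has
-- 5 X + Y ≤ 6 m.  When the 4-cycles are chosen greedily, an edge other than e
-- lies on the 4-cycle through e in direction j for at most one j.  Avoiding the
-- conflicts (X), the edges of earlier 4-cycles (4 X), the edges of color
-- π (dir e) (m) and the opposite edges counted by Y thus excludes at most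
-- 7 m < d directions j.
module Submission where

module Combinatorics where
  open import Defs
  open import Axiom.UniquenessOfIdentityProofs using (module Decidable⇒UIP)
  open import Data.Bool using (true; false; not)
  import Data.Bool.Properties as Bool
  open import Data.Nat using (ℕ; zero; suc; _+_; _*_; _≤_; _<_; _≤?_; z≤n; s≤s; _!; >-nonZero)
  open import Data.Nat.Properties hiding (_≟_; suc-injective; <⇒≢)
  open import Data.Nat.ListAction using (sum)
  open import Data.Nat.ListAction.Properties using (sum-++)
  open import Data.Nat.Solver using (module +-*-Solver)
  open import Data.Fin using (Fin; zero; suc; punchIn; punchOut)
  open import Data.Fin.Properties using (_≟_; suc-injective; <⇒≢; any?; all?; pigeonhole; punchIn-injective; punchInᵢ≢i; punchIn-punchOut; punchOut-injective)
  open import Data.Maybe using (Maybe; just; nothing)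
  open import Data.Maybe.Properties using (just-injective) renaming (≡-dec to Maybe-≡-dec)
  open import Data.Vec using ([]; _∷_; lookup; _[_]≔_)
  open import Data.Vec.Properties using (lookup∘update; lookup∘update′; tabulate∘lookup; tabulate-cong) renaming (≡-dec to Vec-≡-dec)
  open import Data.List using (List; []; _∷_; _++_; map; length; filter; concatMap; allFin; cartesianProductWith; deduplicate)
  open import Data.List.Properties using (map-∘; map-cong; map-++; map-tabulate; length-tabulate; length-map; length-++)
  open import Data.List.Membership.Propositional using (_∈_; _∉_; find; lose)
  open import Data.List.Membership.Propositional.Properties using (∈-allFin; ∈-filter⁺; ∈-filter⁻; ∈-map⁺; ∈-++⁺ˡ; ∈-++⁺ʳ; ∈-concatMap⁺; ∈-cartesianProductWith⁺; ∈-deduplicate⁺)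
  import Data.List.Membership.DecPropositional as DecMembership
  open import Data.List.Membership.Setoid.Properties using (index-injective)
  open import Data.List.Relation.Unary.All as All using ()
  open import Data.List.Relation.Unary.AllPairs using ([]; _∷_)
  open import Data.List.Relation.Unary.Any using (here; there; index) renaming (any? to anyᴸ?)
  open import Data.List.Relation.Unary.Unique.Propositional using (Unique)
  open import Data.List.Relation.Unary.Unique.Propositional.Properties using (filter⁺)
  import Data.List.Relation.Unary.Unique.DecPropositional.Properties as DecUnique
  open import Data.Product using (Σ; ∃; _×_; _,_; proj₁; proj₂)
  open import Data.Sum using (_⊎_; inj₁; inj₂)
  open import Function using (_∘_; id)
  open import Function.Definitions using (Injective)
  open import Relation.Binary.Definitions using (DecidableEquality)
  open import Relation.Binary.PropositionalEquality
  open import Relation.Nullary using (Dec; yes; no; ¬_; contradiction)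
  open import Relation.Nullary.Decidable using (map′; ¬?; _×-dec_; _⊎-dec_; _→-dec_; decidable-stable)
  open import Relation.Unary using (Decidable)
  open ≤-Reasoning

  -- Counting and averaging

  private variable
    A B : Set
    d : ℕ

  ∑ : List A → (A → ℕ) → ℕ
  ∑ xs f = sum (map f xs)

  syntax ∑ xs (λ x → e) = ∑[ x ∈ xs ] e

  ∑-mono : ∀ (xs : List A) {f g : A → ℕ} → (∀ x → f x ≤ g x) → ∑ xs f ≤ ∑ xs g
  ∑-mono []       f≤g = z≤n
  ∑-mono (x ∷ xs) f≤g = +-mono-≤ (f≤g x) (∑-mono xs f≤g)

  ∑-+ : ∀ (xs : List A) (f g : A → ℕ) → ∑[ x ∈ xs ] (f x + g x) ≡ ∑ xs f + ∑ xs g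
  ∑-+ []       f g = refl
  ∑-+ (x ∷ xs) f g rewrite ∑-+ xs f g =
    solve 4 (λ a b c e → a :+ b :+ (c :+ e) := a :+ c :+ (b :+ e)) refl (f x) (g x) (∑ xs f) (∑ xs g)
    where open +-*-Solver

  ∑-*ˡ : ∀ (xs : List A) k (f : A → ℕ) → ∑[ x ∈ xs ] (k * f x) ≡ k * ∑ xs f
  ∑-*ˡ []       k f = sym (*-zeroʳ k)
  ∑-*ˡ (x ∷ xs) k f rewrite ∑-*ˡ xs k f = sym (*-distribˡ-+ k (f x) (∑ xs f))

  ∑-*ʳ : ∀ (xs : List A) (f : A → ℕ) k → ∑[ x ∈ xs ] (f x * k) ≡ ∑ xs f * k
  ∑-*ʳ []       f k = refl
  ∑-*ʳ (x ∷ xs) f k rewrite ∑-*ʳ xs f k = sym (*-distribʳ-+ k (f x) (∑ xs f))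

  ∑-const : ∀ (xs : List A) k → ∑[ _ ∈ xs ] k ≡ length xs * k
  ∑-const []       k = refl
  ∑-const (x ∷ xs) k = cong (k +_) (∑-const xs k)

  ∑-zero : ∀ (xs : List A) {f : A → ℕ} → (∀ x → f x ≡ 0) → ∑ xs f ≡ 0
  ∑-zero []       f≡0 = refl
  ∑-zero (x ∷ xs) f≡0 = cong₂ _+_ (f≡0 x) (∑-zero xs f≡0)

  ∑-swap : ∀ (xs : List A) (ys : List B) (f : A → B → ℕ) →
           ∑[ x ∈ xs ] ∑[ y ∈ ys ] f x y ≡ ∑[ y ∈ ys ] ∑[ x ∈ xs ] f x y
  ∑-swap []       ys f = sym (∑-zero ys (λ _ → refl))
  ∑-swap (x ∷ xs) ys f rewrite ∑-swap xs ys f = sym (∑-+ ys (f x) _)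

  ∑-++ : ∀ (xs ys : List A) (f : A → ℕ) → ∑ (xs ++ ys) f ≡ ∑ xs f + ∑ ys f
  ∑-++ xs ys f rewrite map-++ f xs ys = sum-++ (map f xs) (map f ys)

  ∑-concatMap : ∀ (h : A → List B) xs (f : B → ℕ) → ∑ (concatMap h xs) f ≡ ∑[ x ∈ xs ] ∑ (h x) f
  ∑-concatMap h []       f = refl
  ∑-concatMap h (x ∷ xs) f = trans (∑-++ (h x) _ f) (cong (∑ (h x) f +_) (∑-concatMap h xs f))

  ∑-map : ∀ (h : A → B) xs (f : B → ℕ) → ∑ (map h xs) f ≡ ∑ xs (f ∘ h)
  ∑-map h xs f = cong sum (sym (map-∘ xs))

  ∑-allFin-suc : ∀ {n} (f : Fin (suc n) → ℕ) → ∑ (allFin (suc n)) f ≡ f zero + ∑ (allFin n) (f ∘ suc)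
  ∑-allFin-suc f = cong (λ ys → f zero + sum ys) (trans (map-tabulate suc f) (sym (map-tabulate id (f ∘ suc))))

  ∑-allFin-const : ∀ n k → ∑[ _ ∈ allFin n ] k ≡ n * k
  ∑-allFin-const n k = trans (∑-const (allFin n) k) (cong (_* k) (length-tabulate {n = n} id))

  ∈⇒≤∑ : ∀ {x : A} {xs} (f : A → ℕ) → x ∈ xs → f x ≤ ∑ xs f
  ∈⇒≤∑ f (here refl) = m≤m+n _ _
  ∈⇒≤∑ f (there x∈)  = ≤-trans (∈⇒≤∑ f x∈) (m≤n+m _ _)

  -- If every value exceeded `b`, the sum would reach `length xs * suc b`, which for a nonempty list
  -- is more than `length xs * b`.
  ∃-≤average : ∀ (xs : List A) (f : A → ℕ) b → 0 < length xs → ∑ xs f ≤ length xs * b → ∃ λ x → f x ≤ b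
  ∃-≤average {A = A} xs f b 0<n ∑≤ with below-or-large xs
    where
    below-or-large : ∀ (xs : List A) → (∃ λ x → f x ≤ b) ⊎ length xs * suc b ≤ ∑ xs f
    below-or-large []       = inj₂ z≤n
    below-or-large (x ∷ xs) with f x ≤? b | below-or-large xs
    ... | yes fx≤b | _         = inj₁ (x , fx≤b)
    ... | no  _    | inj₁ p    = inj₁ p
    ... | no  fx≰b | inj₂ large = inj₂ (+-mono-≤ (≰⇒> fx≰b) large)
  ... | inj₁ p     = p
  ... | inj₂ large = contradiction (≤-trans large ∑≤) (<⇒≱ (*-monoʳ-< (length xs) {{>-nonZero 0<n}} ≤-refl))

  𝟙 : ∀ {P : Set} → Dec P → ℕ
  𝟙 (yes _) = 1
  𝟙 (no  _) = 0

  𝟙-yes : ∀ {P : Set} (p? : Dec P) → P → 𝟙 p? ≡ 1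
  𝟙-yes (yes _) _ = refl
  𝟙-yes (no ¬p) p = contradiction p ¬p

  𝟙-no : ∀ {P : Set} (p? : Dec P) → ¬ P → 𝟙 p? ≡ 0
  𝟙-no (yes p) ¬p = contradiction p ¬p
  𝟙-no (no _)  _  = refl

  𝟙-mono : ∀ {P Q : Set} (p? : Dec P) (q? : Dec Q) → (P → Q) → 𝟙 p? ≤ 𝟙 q?
  𝟙-mono (yes p) q? p⇒q = ≤-reflexive (sym (𝟙-yes q? (p⇒q p)))
  𝟙-mono (no _)  q? p⇒q = z≤n

  length-filter≡∑𝟙 : ∀ {P : A → Set} (P? : Decidable P) xs → length (filter P? xs) ≡ ∑ xs (𝟙 ∘ P?)
  length-filter≡∑𝟙 P? []       = refl
  length-filter≡∑𝟙 P? (x ∷ xs) with P? x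
  ... | yes _ = cong suc (length-filter≡∑𝟙 P? xs)
  ... | no  _ = length-filter≡∑𝟙 P? xs

  ∑-𝟙-≟ : ∀ {n} (c : Fin n) → ∑[ k ∈ allFin n ] 𝟙 (k ≟ c) ≡ 1
  ∑-𝟙-≟ {suc n} zero = trans (∑-allFin-suc {n} (λ k → 𝟙 (k ≟ zero))) (cong suc (∑-zero (allFin n) (λ _ → refl)))
  ∑-𝟙-≟ {suc n} (suc c) = trans (∑-allFin-suc (λ k → 𝟙 (k ≟ suc c)))
    (trans (≤-antisym (∑-mono (allFin n) (λ k → 𝟙-mono (suc k ≟ suc c) (k ≟ c) suc-injective))
                      (∑-mono (allFin n) (λ k → 𝟙-mono (k ≟ c) (suc k ≟ suc c) (cong suc))))
           (∑-𝟙-≟ c))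

  -- Putting `M` in the vacant place `c` leaves every term at most `M`. The saved term stands on the
  -- left as a summand, which avoids truncated subtraction.
  ∑-omit : ∀ {n} (f : Fin n → ℕ) M c → f c ≡ 0 → (∀ k → k ≢ c → f k ≤ M) →
           ∑ (allFin n) f + M ≤ n * M
  ∑-omit {n} f M c fc≡0 f≤M = begin
    ∑ (allFin n) f + M                           ≡⟨ cong (∑ (allFin n) f +_) M≡ ⟩
    ∑ (allFin n) f + ∑[ k ∈ allFin n ] (𝟙 (k ≟ c) * M) ≡⟨ ∑-+ (allFin n) f _ ⟨
    ∑[ k ∈ allFin n ] (f k + 𝟙 (k ≟ c) * M)      ≤⟨ ∑-mono (allFin n) pointwise ⟩
    ∑[ _ ∈ allFin n ] M                          ≡⟨ ∑-allFin-const n M ⟩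
    n * M                                        ∎
    where
    M≡ : M ≡ ∑[ k ∈ allFin n ] (𝟙 (k ≟ c) * M)
    M≡ = sym (trans (∑-*ʳ (allFin n) _ M) (trans (cong (_* M) (∑-𝟙-≟ c)) (*-identityˡ M)))
    pointwise : ∀ k → f k + 𝟙 (k ≟ c) * M ≤ M
    pointwise k with k ≟ c
    ... | yes refl = ≤-reflexive (cong₂ _+_ fc≡0 (*-identityˡ M))
    ... | no  k≢c  = ≤-trans (≤-reflexive (+-identityʳ (f k))) (f≤M k k≢c)

  -- Filling the place `c` with `M` leaves `c′` vacant because `c ≢ c′`, so the bound for one vacant
  -- place applies.
  ∑-omit₂ : ∀ {n} (f : Fin n → ℕ) M c c′ → c ≢ c′ → f c ≡ 0 → f c′ ≡ 0 →
            (∀ k → k ≢ c → k ≢ c′ → f k ≤ M) → ∑ (allFin n) f + (M + M) ≤ n * M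
  ∑-omit₂ {n} f M c c′ c≢c′ fc≡0 fc′≡0 f≤M = begin
    ∑ (allFin n) f + (M + M)     ≡⟨ +-assoc (∑ (allFin n) f) M M ⟨
    ∑ (allFin n) f + M + M       ≡⟨ cong (λ s → ∑ (allFin n) f + s + M) M≡ ⟩
    ∑ (allFin n) f + ∑[ k ∈ allFin n ] (𝟙 (k ≟ c) * M) + M ≡⟨ cong (_+ M) (∑-+ (allFin n) f _) ⟨
    ∑[ k ∈ allFin n ] (f k + 𝟙 (k ≟ c) * M) + M ≤⟨ ∑-omit _ M c′ at-c′ pointwise ⟩
    n * M ∎
    where
    M≡ : M ≡ ∑[ k ∈ allFin n ] (𝟙 (k ≟ c) * M)
    M≡ = sym (trans (∑-*ʳ (allFin n) _ M) (trans (cong (_* M) (∑-𝟙-≟ c)) (*-identityˡ M)))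
    at-c′ : f c′ + 𝟙 (c′ ≟ c) * M ≡ 0
    at-c′ = cong₂ _+_ fc′≡0 (cong (_* M) (𝟙-no (c′ ≟ c) (c≢c′ ∘ sym)))
    pointwise : ∀ k → k ≢ c′ → f k + 𝟙 (k ≟ c) * M ≤ M
    pointwise k k≢c′ with k ≟ c
    ... | yes refl = ≤-reflexive (cong₂ _+_ fc≡0 (*-identityˡ M))
    ... | no  k≢c  = ≤-trans (≤-reflexive (+-identityʳ (f k))) (f≤M k k≢c k≢c′)

  -- Permutations and counts of those with prescribed values

  Perm : ℕ → Set
  Perm n = Σ (Fin n → Fin n) (Injective _≡_ _≡_)

  extend : ∀ {n} → Fin (suc n) → Perm n → Perm (suc n)
  extend {n} k (π , π-inj) = π′ , inj
    where
    π′ : Fin (suc n) → Fin (suc n)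
    π′ zero    = k
    π′ (suc i) = punchIn k (π i)
    inj : Injective _≡_ _≡_ π′
    inj {zero}  {zero}  _  = refl
    inj {zero}  {suc j} eq = contradiction (sym eq) (punchInᵢ≢i k (π j))
    inj {suc i} {zero}  eq = contradiction eq (punchInᵢ≢i k (π i))
    inj {suc i} {suc j} eq = cong suc (π-inj (punchIn-injective k _ _ eq))

  -- Permutations are grouped by the image `k` of `zero`. The averaging draws on the length `n !` of
  -- this list and on upper bounds for its entries with prescribed values.
  perms : ∀ n → List (Perm n)
  perms zero    = (id , id) ∷ []
  perms (suc n) = concatMap (λ k → map (extend k) (perms n)) (allFin (suc n))

  ∑-perms-suc : ∀ n (f : Perm (suc n) → ℕ) →
                ∑ (perms (suc n)) f ≡ ∑[ k ∈ allFin (suc n) ] ∑[ π ∈ perms n ] f (extend k π)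
  ∑-perms-suc n f = trans (∑-concatMap (λ k → map (extend k) (perms n)) (allFin (suc n)) f)
    (cong sum (map-cong (λ k → ∑-map (extend k) (perms n) f) (allFin (suc n))))

  ∑-perms-const : ∀ n k → ∑[ _ ∈ perms n ] k ≡ n ! * k
  ∑-perms-const zero    k = refl
  ∑-perms-const (suc n) k = begin-equality
    ∑[ _ ∈ perms (suc n) ] k                     ≡⟨ ∑-perms-suc n _ ⟩
    ∑[ _ ∈ allFin (suc n) ] ∑[ _ ∈ perms n ] k   ≡⟨ ∑-allFin-const (suc n) _ ⟩
    suc n * ∑[ _ ∈ perms n ] k                   ≡⟨ cong (suc n *_) (∑-perms-const n k) ⟩
    suc n * (n ! * k)                            ≡⟨ *-assoc (suc n) (n !) k ⟨
    suc n * n ! * k                              ∎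

  length-perms : ∀ n → length (perms n) ≡ n !
  length-perms n = trans (sym (trans (∑-const (perms n) 1) (*-identityʳ _)))
                         (trans (∑-perms-const n 1) (*-identityʳ _))

  -- Group by the image `k` of `zero`. For `i = zero` only the group `k = c` counts. Otherwise that
  -- group contributes nothing, since `punchIn c` omits `c`, and `punchOut` turns each other group
  -- into an instance one size smaller.
  ∑-perms-fixed : ∀ n (i c : Fin (suc n)) → ∑[ π ∈ perms (suc n) ] 𝟙 (proj₁ π i ≟ c) ≤ n !
  ∑-perms-fixed n zero c = begin
    ∑[ π ∈ perms (suc n) ] 𝟙 (proj₁ π zero ≟ c)          ≡⟨ ∑-perms-suc n _ ⟩
    ∑[ k ∈ allFin (suc n) ] ∑[ _ ∈ perms n ] 𝟙 (k ≟ c)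
      ≤⟨ ∑-mono (allFin (suc n)) (λ k → ≤-reflexive (∑-perms-const n (𝟙 (k ≟ c)))) ⟩
    ∑[ k ∈ allFin (suc n) ] (n ! * 𝟙 (k ≟ c))             ≡⟨ ∑-*ˡ (allFin (suc n)) (n !) _ ⟩
    n ! * ∑[ k ∈ allFin (suc n) ] 𝟙 (k ≟ c)               ≡⟨ cong (n ! *_) (∑-𝟙-≟ c) ⟩
    n ! * 1                                               ≡⟨ *-identityʳ (n !) ⟩
    n !                                                   ∎
  ∑-perms-fixed (suc n) (suc i) c = +-cancelʳ-≤ (n !) _ _ (begin
    ∑[ π ∈ perms (2 + n) ] 𝟙 (proj₁ π (suc i) ≟ c) + n !  ≡⟨ cong (_+ n !) (∑-perms-suc (suc n) _) ⟩
    ∑[ k ∈ allFin (2 + n) ] ∑[ π ∈ perms (suc n) ] 𝟙 (punchIn k (proj₁ π i) ≟ c) + n !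
      ≤⟨ ∑-omit _ (n !) c at-c off-c ⟩
    (2 + n) * n !                                         ≡⟨ +-comm (n !) (suc n * n !) ⟩
    suc n * n ! + n !                                     ∎)
    where
    at-c : ∑[ π ∈ perms (suc n) ] 𝟙 (punchIn c (proj₁ π i) ≟ c) ≡ 0
    at-c = ∑-zero (perms (suc n)) (λ π → 𝟙-no (punchIn c (proj₁ π i) ≟ c) (punchInᵢ≢i c _))
    off-c : ∀ k → k ≢ c → ∑[ π ∈ perms (suc n) ] 𝟙 (punchIn k (proj₁ π i) ≟ c) ≤ n !
    off-c k k≢c = ≤-trans
      (∑-mono (perms (suc n)) (λ π → 𝟙-mono (_ ≟ c) (proj₁ π i ≟ punchOut k≢c)
        (λ eq → punchIn-injective k _ _ (trans eq (sym (punchIn-punchOut k≢c))))))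
      (∑-perms-fixed n i (punchOut k≢c))

  -- The first factor selects the group `k = c`; within it, one value of a smaller permutation
  -- remains prescribed.
  ∑-perms-fixed₂-zero : ∀ n (j : Fin (suc n)) (c c′ : Fin (2 + n)) → c ≢ c′ →
    ∑[ π ∈ perms (2 + n) ] (𝟙 (proj₁ π zero ≟ c) * 𝟙 (proj₁ π (suc j) ≟ c′)) ≤ n !
  ∑-perms-fixed₂-zero n j c c′ c≢c′ = begin
    ∑[ π ∈ perms (2 + n) ] (𝟙 (proj₁ π zero ≟ c) * 𝟙 (proj₁ π (suc j) ≟ c′)) ≡⟨ ∑-perms-suc (suc n) _ ⟩
    ∑[ k ∈ allFin (2 + n) ] ∑[ π ∈ perms (suc n) ] (𝟙 (k ≟ c) * 𝟙 (punchIn k (proj₁ π j) ≟ c′))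
      ≤⟨ ∑-mono (allFin (2 + n)) pointwise ⟩
    ∑[ k ∈ allFin (2 + n) ] (n ! * 𝟙 (k ≟ c))  ≡⟨ ∑-*ˡ (allFin (2 + n)) (n !) _ ⟩
    n ! * ∑[ k ∈ allFin (2 + n) ] 𝟙 (k ≟ c)    ≡⟨ cong (n ! *_) (∑-𝟙-≟ c) ⟩
    n ! * 1                                    ≡⟨ *-identityʳ (n !) ⟩
    n !                                        ∎
    where
    pointwise : ∀ k → ∑[ π ∈ perms (suc n) ] (𝟙 (k ≟ c) * 𝟙 (punchIn k (proj₁ π j) ≟ c′)) ≤ n ! * 𝟙 (k ≟ c)
    pointwise k with k ≟ c
    ... | no  _    = ≤-trans (≤-reflexive (∑-zero (perms (suc n)) (λ _ → refl))) z≤n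
    ... | yes refl = begin
      ∑[ π ∈ perms (suc n) ] (1 * 𝟙 (punchIn c (proj₁ π j) ≟ c′))
        ≤⟨ ∑-mono (perms (suc n)) (λ π → ≤-trans (≤-reflexive (*-identityˡ _))
             (𝟙-mono (_ ≟ c′) (proj₁ π j ≟ punchOut c≢c′)
               (λ eq → punchIn-injective c _ _ (trans eq (sym (punchIn-punchOut c≢c′)))))) ⟩
      ∑[ π ∈ perms (suc n) ] 𝟙 (proj₁ π j ≟ punchOut c≢c′)  ≤⟨ ∑-perms-fixed n j (punchOut c≢c′) ⟩
      n !      ≡⟨ *-identityʳ (n !) ⟨
      n ! * 1  ∎

  -- When neither position is `zero`, the groups `k = c` and `k = c′` contribute nothing, and each
  -- other group is an instance one size smaller.
  ∑-perms-fixed₂-≢ : ∀ n (i j c c′ : Fin (2 + n)) → i ≢ j → c ≢ c′ →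
    ∑[ π ∈ perms (2 + n) ] (𝟙 (proj₁ π i ≟ c) * 𝟙 (proj₁ π j ≟ c′)) ≤ n !
  ∑-perms-fixed₂-≢ n zero    zero    c c′ i≢j c≢c′ = contradiction refl i≢j
  ∑-perms-fixed₂-≢ n zero    (suc j) c c′ i≢j c≢c′ = ∑-perms-fixed₂-zero n j c c′ c≢c′
  ∑-perms-fixed₂-≢ n (suc i) zero    c c′ i≢j c≢c′ = ≤-trans
    (∑-mono (perms (2 + n)) (λ π → ≤-reflexive (*-comm (𝟙 (proj₁ π (suc i) ≟ c)) _)))
    (∑-perms-fixed₂-zero n i c′ c (c≢c′ ∘ sym))
  ∑-perms-fixed₂-≢ zero (suc zero) (suc zero) c c′ i≢j c≢c′ = contradiction refl i≢j
  ∑-perms-fixed₂-≢ (suc n) (suc i) (suc j) c c′ i≢j c≢c′ = +-cancelʳ-≤ (n ! + n !) _ _ (begin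
    ∑[ π ∈ perms (3 + n) ] (𝟙 (proj₁ π (suc i) ≟ c) * 𝟙 (proj₁ π (suc j) ≟ c′)) + (n ! + n !)
      ≡⟨ cong (_+ (n ! + n !)) (∑-perms-suc (2 + n) _) ⟩
    ∑ (allFin (3 + n)) t + (n ! + n !)
      ≤⟨ ∑-omit₂ t (n !) c c′ c≢c′ at-c at-c′ off ⟩
    (3 + n) * n !               ≡⟨ +-assoc (n !) (n !) (suc n * n !) ⟨
    n ! + n ! + suc n * n !     ≡⟨ +-comm (n ! + n !) (suc n * n !) ⟩
    suc n * n ! + (n ! + n !)   ∎)
    where
    t : Fin (3 + n) → ℕ
    t k = ∑[ π ∈ perms (2 + n) ] (𝟙 (punchIn k (proj₁ π i) ≟ c) * 𝟙 (punchIn k (proj₁ π j) ≟ c′))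
    at-c : t c ≡ 0
    at-c = ∑-zero (perms (2 + n)) (λ π → cong (_* _) (𝟙-no (_ ≟ c) (punchInᵢ≢i c _)))
    at-c′ : t c′ ≡ 0
    at-c′ = ∑-zero (perms (2 + n)) (λ π →
      trans (cong (𝟙 (punchIn c′ (proj₁ π i) ≟ c) *_) (𝟙-no (_ ≟ c′) (punchInᵢ≢i c′ _)))
            (*-zeroʳ (𝟙 (punchIn c′ (proj₁ π i) ≟ c))))
    pull : ∀ k {x c} (k≢c : k ≢ c) → punchIn k x ≡ c → x ≡ punchOut k≢c
    pull k k≢c eq = punchIn-injective k _ _ (trans eq (sym (punchIn-punchOut k≢c)))
    off : ∀ k → k ≢ c → k ≢ c′ → t k ≤ n !
    off k k≢c k≢c′ = ≤-trans
      (∑-mono (perms (2 + n)) (λ π → *-mono-≤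
        (𝟙-mono (_ ≟ c) (proj₁ π i ≟ punchOut k≢c) (pull k k≢c))
        (𝟙-mono (_ ≟ c′) (proj₁ π j ≟ punchOut k≢c′) (pull k k≢c′))))
      (∑-perms-fixed₂-≢ n i j _ _ (i≢j ∘ cong suc)
        (c≢c′ ∘ punchOut-injective k≢c k≢c′))

  -- For equal targets the sum vanishes, because an injective map cannot take one value at two
  -- positions.
  ∑-perms-fixed₂ : ∀ n (i j c c′ : Fin (2 + n)) → i ≢ j →
    ∑[ π ∈ perms (2 + n) ] (𝟙 (proj₁ π i ≟ c) * 𝟙 (proj₁ π j ≟ c′)) ≤ n !
  ∑-perms-fixed₂ n i j c c′ i≢j with c ≟ c′
  ... | no  c≢c′ = ∑-perms-fixed₂-≢ n i j c c′ i≢j c≢c′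
  ... | yes refl = ≤-trans (≤-reflexive (∑-zero (perms (2 + n)) clash)) z≤n
    where
    clash : ∀ (π : Perm (2 + n)) → 𝟙 (proj₁ π i ≟ c) * 𝟙 (proj₁ π j ≟ c) ≡ 0
    clash (π , π-inj) with π i ≟ c
    ... | yes πi≡c = trans (+-identityʳ _) (𝟙-no (π j ≟ c) (λ πj≡c → i≢j (π-inj (trans πi≡c (sym πj≡c)))))
    ... | no  _    = refl

  -- Edges and squares of the hypercube

  -- If every element of `Fin d` occurred in `xs`, the positions of these occurrences would embed
  -- `Fin d` into fewer than `d` places.
  ∃-∉ : (xs : List (Fin d)) → length xs < d → ∃ λ j → j ∉ xs
  ∃-∉ {d} xs short with any? (λ j → ¬? (DecMembership._∈?_ _≟_ j xs))
  ... | yes p   = p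
  ... | no  ¬∃∉ = let i , j , i<j , eq = pigeonhole short (index ∘ all∈) in
    contradiction (index-injective (setoid (Fin d)) (all∈ i) (all∈ j) eq) (<⇒≢ i<j)
    where
    all∈ : ∀ j → j ∈ xs
    all∈ j = decidable-stable (DecMembership._∈?_ _≟_ j xs) (λ j∉ → ¬∃∉ (j , j∉))

  vertex-ext : {u v : Vertex d} → (∀ l → lookup u l ≡ lookup v l) → u ≡ v
  vertex-ext {u = u} {v} eq = trans (sym (tabulate∘lookup u)) (trans (tabulate-cong eq) (tabulate∘lookup v))

  -- The field `low` fixes the remaining coordinate to `false` on both sides, and its two proofs
  -- coincide because equality of booleans is decidable.
  edge-ext : (e e′ : Edge d) → dir e ≡ dir e′ →
             (∀ l → l ≢ dir e → lookup (base e) l ≡ lookup (base e′) l) → e ≡ e′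
  edge-ext (edge u i u-low) (edge v .i v-low) refl agree with vertex-ext {u = u} {v} everywhere
    where
    everywhere : ∀ l → lookup u l ≡ lookup v l
    everywhere l with l ≟ i
    ... | yes refl = trans u-low (sym v-low)
    ... | no  l≢i  = agree l l≢i
  ... | refl = cong (edge u i) (Decidable⇒UIP.≡-irrelevant Bool._≟_ u-low v-low)

  _≟ᴱ_ : DecidableEquality (Edge d)
  e ≟ᴱ e′ = map′ (λ (p , q) → edge-ext e e′ p (λ l _ → cong (λ v → lookup v l) q))
                 (λ { refl → refl , refl })
                 (dir e ≟ dir e′ ×-dec Vec-≡-dec Bool._≟_ (base e) (base e′))

  edgeAt : Vertex d → Fin d → Edge d
  edgeAt v i = edge (v [ i ]≔ false) i (lookup∘update i v false)

  edgeAt-base : (v : Vertex d) (i : Fin d) {l : Fin d} → l ≢ i → lookup (base (edgeAt v i)) l ≡ lookup v l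
  edgeAt-base v i l≢i = lookup∘update′ l≢i v false

  allVertices : ∀ d → List (Vertex d)
  allVertices zero    = [] ∷ []
  allVertices (suc d) = cartesianProductWith _∷_ (true ∷ false ∷ []) (allVertices d)

  ∈-allVertices : (v : Vertex d) → v ∈ allVertices d
  ∈-allVertices []      = here refl
  ∈-allVertices (b ∷ v) = ∈-cartesianProductWith⁺ _∷_ (∈-Bool b) (∈-allVertices v)
    where
    ∈-Bool : ∀ b → b ∈ true ∷ false ∷ []
    ∈-Bool true  = here refl
    ∈-Bool false = there (here refl)

  -- `edgeAt` yields every edge twice, once from each endpoint; hence the removal of duplicates.
  allEdges : ∀ d → List (Edge d)
  allEdges d = deduplicate _≟ᴱ_ (cartesianProductWith edgeAt (allVertices d) (allFin d))

  allEdges-unique : ∀ d → Unique (allEdges d)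
  allEdges-unique d = DecUnique.deduplicate-! _≟ᴱ_ (cartesianProductWith edgeAt (allVertices d) (allFin d))

  ∈-allEdges : (e : Edge d) → e ∈ allEdges d
  ∈-allEdges {d} e = ∈-deduplicate⁺ _≟ᴱ_ (subst (_∈ cartesianProductWith edgeAt (allVertices d) (allFin d))
    (edge-ext _ e refl (λ l → edgeAt-base (base e) (dir e)))
    (∈-cartesianProductWith⁺ edgeAt (∈-allVertices (base e)) (∈-allFin (dir e))))

  -- Leaving the coordinate `dir e` free treats both endpoints at once.
  Incident : Vertex d → Edge d → Set
  Incident v e = ∀ l → l ≢ dir e → lookup v l ≡ lookup (base e) l

  endpoint⇒incident : {v : Vertex d} {e : Edge d} → Endpoint v e → Incident v e
  endpoint⇒incident         (inj₁ refl) l l≢ = refl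
  endpoint⇒incident {e = e} (inj₂ refl) l l≢ = lookup∘update′ l≢ (base e) true

  edgeAt-incident : (v : Vertex d) (i : Fin d) → Incident v (edgeAt v i)
  edgeAt-incident v i l l≢i = sym (edgeAt-base v i l≢i)

  incident-unique : (v : Vertex d) (x y : Edge d) → Incident v x → Incident v y → dir x ≡ dir y → x ≡ y
  incident-unique v x y vx vy eq =
    edge-ext x y eq (λ l l≢ → trans (sym (vx l l≢)) (vy l (l≢ ∘ (λ p → trans p (sym eq)))))

  -- (e , j) stands for the 4-cycle through e in directions dir e and j.
  Square : ℕ → Set
  Square d = Edge d × Fin d

  Spans : Square d → Fin d → Set
  Spans (e , j) k = k ≡ dir e ⊎ k ≡ j

  -- For `j ≢ dir e` this describes the four vertices of the 4-cycle.
  AgreesOff : Vertex d → Square d → Set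
  AgreesOff v (e , j) = ∀ l → l ≢ dir e → l ≢ j → lookup v l ≡ lookup (base e) l

  _∈□_ : Edge d → Square d → Set
  x ∈□ s = Spans s (dir x) × AgreesOff (base x) s

  _∈□?_ : (x : Edge d) (s : Square d) → Dec (x ∈□ s)
  x ∈□? (e , j) = (dir x ≟ dir e ⊎-dec dir x ≟ j) ×-dec
    all? (λ l → ¬? (l ≟ dir e) →-dec ¬? (l ≟ j) →-dec lookup (base x) l Bool.≟ lookup (base e) l)

  e∈□ : (e : Edge d) (j : Fin d) → e ∈□ (e , j)
  e∈□ e j = inj₁ refl , λ _ _ _ → refl

  -- `v` and `base x` can differ only in the coordinate `dir x`, which the square spans.
  ∈□⇒agreesOff : (v : Vertex d) (x : Edge d) (s : Square d) → Incident v x → x ∈□ s → AgreesOff v s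
  ∈□⇒agreesOff v x (e , j) vx (k , agree) l l≢i l≢j = trans (vx l (l≢dir k)) (agree l l≢i l≢j)
    where
    l≢dir : Spans (e , j) (dir x) → l ≢ dir x
    l≢dir (inj₁ p) q = l≢i (trans q p)
    l≢dir (inj₂ p) q = l≢j (trans q p)

  agreesOff⇒∈□ : (v : Vertex d) (x : Edge d) (s : Square d) → Incident v x →
                 Spans s (dir x) → AgreesOff v s → x ∈□ s
  agreesOff⇒∈□ v x (e , j) vx k agree =
    k , λ l l≢i l≢j → trans (sym (vx l (l≢dir k l≢i l≢j))) (agree l l≢i l≢j)
    where
    l≢dir : Spans (e , j) (dir x) → ∀ {l} → l ≢ dir e → l ≢ j → l ≢ dir x
    l≢dir (inj₁ p) l≢i l≢j q = l≢i (trans q p)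
    l≢dir (inj₂ p) l≢i l≢j q = l≢j (trans q p)

  opposite : Edge d → Fin d → Edge d
  opposite e j = edgeAt (base e [ j ]≔ not (lookup (base e) j)) (dir e)

  -- Since `x ≢ e`, the two bases differ, and `j` is the only coordinate in which they can.
  ∈□-sameDir : {e x : Edge d} {j : Fin d} → x ∈□ (e , j) → x ≢ e → dir x ≡ dir e → x ≡ opposite e j
  ∈□-sameDir {e = e} {x} {j} (_ , agree) x≢e dir≡ = edge-ext x (opposite e j) dir≡ agree′
    where
    flipped = base e [ j ]≔ not (lookup (base e) j)
    differ : lookup (base x) j ≢ lookup (base e) j
    differ same = x≢e (edge-ext x e dir≡ λ l l≢ → case l (λ p → l≢ (trans p (sym dir≡))))
      where
      case : ∀ l → l ≢ dir e → lookup (base x) l ≡ lookup (base e) l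
      case l l≢i with l ≟ j
      ... | yes refl = same
      ... | no  l≢j  = agree l l≢i l≢j
    agree′ : ∀ l → l ≢ dir x → lookup (base x) l ≡ lookup (base (opposite e j)) l
    agree′ l l≢ with l ≟ j
    ... | yes refl = sym (trans (edgeAt-base flipped (dir e) (λ p → l≢ (trans p (sym dir≡))))
                         (trans (lookup∘update j (base e) _) (sym (Bool.¬-not differ))))
    ... | no  l≢j  = trans (agree l (λ p → l≢ (trans p (sym dir≡))) l≢j)
                       (sym (trans (edgeAt-base flipped (dir e) (λ p → l≢ (trans p (sym dir≡))))
                                   (lookup∘update′ l≢j (base e) _)))

  squareEdges : Square d → List (Edge d)
  squareEdges (e , j) = e ∷ opposite e j ∷ edgeAt (base e) j ∷ edgeAt (top e) j ∷ []

  ∈□⇒∈squareEdges : (x : Edge d) (s : Square d) → x ∈□ s → x ∈ squareEdges s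
  ∈□⇒∈squareEdges x (e , j) x∈ with x ≟ᴱ e | dir x ≟ dir e
  ... | yes x≡e | _        = here x≡e
  ... | no  x≢e | yes dir≡ = there (here (∈□-sameDir x∈ x≢e dir≡))
  ∈□⇒∈squareEdges x (e , j) (inj₁ p , _) | no _ | no dir≢ = contradiction p dir≢
  -- An edge in direction `j` is located by its value in the coordinate `dir e`: `false` places it
  -- at `base e`, `true` at `top e`.
  ∈□⇒∈squareEdges x (e , j) (inj₂ refl , agree) | no _ | no dir≢ with lookup (base x) (dir e) in eq
  ... | false = there (there (here (edge-ext x _ refl via-base)))
    where
    via-base : ∀ l → l ≢ dir x → lookup (base x) l ≡ lookup (base (edgeAt (base e) (dir x))) l
    via-base l l≢ with l ≟ dir e
    ... | yes refl = trans eq (sym (trans (edgeAt-base (base e) _ l≢) (low e)))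
    ... | no  l≢i  = trans (agree l l≢i l≢) (sym (edgeAt-base (base e) _ l≢))
  ... | true  = there (there (there (here (edge-ext x _ refl via-top))))
    where
    via-top : ∀ l → l ≢ dir x → lookup (base x) l ≡ lookup (base (edgeAt (top e) (dir x))) l
    via-top l l≢ with l ≟ dir e
    ... | yes refl = trans eq (sym (trans (edgeAt-base (top e) _ l≢) (lookup∘update l (base e) true)))
    ... | no  l≢i  = trans (agree l l≢i l≢)
                       (sym (trans (edgeAt-base (top e) _ l≢) (lookup∘update′ l≢i (base e) true)))

  -- An edge x ≢ e lies on the square (e , j) for at most one j, namely this one.
  squareDir : Edge d → Edge d → Fin d
  squareDir e x with dir x ≟ dir e | any? (λ l → ¬? (lookup (base x) l Bool.≟ lookup (base e) l))
  ... | no  _ | _           = dir x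
  ... | yes _ | yes (l , _) = l
  ... | yes _ | no  _       = dir e

  -- At `x = e` no coordinate differs, so the default value is returned. It makes `dir e` forbidden
  -- as soon as `e` is among the avoided edges.
  squareDir-self : (e : Edge d) → squareDir e e ≡ dir e
  squareDir-self e with dir e ≟ dir e | any? (λ l → ¬? (lookup (base e) l Bool.≟ lookup (base e) l))
  ... | no  ≢ | _           = contradiction refl ≢
  ... | yes _ | yes (l , p) = contradiction refl p
  ... | yes _ | no  _       = refl

  squareDir-unique : {e x : Edge d} {j : Fin d} → x ∈□ (e , j) → x ≢ e → squareDir e x ≡ j
  squareDir-unique {e = e} {x} {j} (k , agree) x≢e
    with dir x ≟ dir e | any? (λ l → ¬? (lookup (base x) l Bool.≟ lookup (base e) l))
  ... | no  dir≢ | _     with k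
  ...   | inj₁ p = contradiction p dir≢
  ...   | inj₂ p = p
  squareDir-unique {e = e} {x} {j} (k , agree) x≢e | yes dir≡ | yes (l , differ) with l ≟ j | l ≟ dir e
  ... | yes l≡j | _        = l≡j
  ... | no  _   | yes refl = contradiction
    (trans (subst (λ i → lookup (base x) i ≡ false) dir≡ (low x)) (sym (low e))) differ
  ... | no  l≢j | no  l≢i  = contradiction (agree l l≢i l≢j) differ
  squareDir-unique {e = e} {x} {j} (k , agree) x≢e | yes dir≡ | no same = contradiction
    (edge-ext x e dir≡ (λ l _ → decidable-stable (_ Bool.≟ _) (λ differ → same (l , differ)))) x≢e

  -- On the two directions of the square this is their transposition; it is applied to directions of
  -- edges on the square.
  swap : Square d → Fin d → Fin d
  swap (e , j) k with k ≟ dir e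
  ... | yes _ = j
  ... | no  _ = dir e

  swap-dir : (e : Edge d) (j : Fin d) {k : Fin d} → k ≡ dir e → swap (e , j) k ≡ j
  swap-dir e j {k} k≡ with k ≟ dir e
  ... | yes _ = refl
  ... | no  k≢ = contradiction k≡ k≢

  swap-spans : (s : Square d) (k : Fin d) → Spans s (swap s k)
  swap-spans (e , j) k with k ≟ dir e
  ... | yes _ = inj₂ refl
  ... | no  _ = inj₁ refl

  swap-injective : (e : Edge d) (j : Fin d) → j ≢ dir e → ∀ {k l} → Spans (e , j) k → Spans (e , j) l →
                   swap (e , j) k ≡ swap (e , j) l → k ≡ l
  swap-injective e j j≢ {k} {l} sk sl eq with k ≟ dir e | l ≟ dir e
  ... | yes p | yes q = trans p (sym q)
  ... | yes p | no  _ = contradiction eq j≢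
  ... | no  _ | yes _ = contradiction (sym eq) j≢
  swap-injective e j j≢ (inj₁ p) _ eq | no k≢ | no _ = contradiction p k≢
  swap-injective e j j≢ (inj₂ _) (inj₁ q) eq | no _ | no l≢ = contradiction q l≢
  swap-injective e j j≢ (inj₂ p) (inj₂ q) eq | no _ | no _ = trans p (sym q)

  -- Resolving conflicts on edge-disjoint squares

  _≟ᴹ_ : ∀ {d} (x y : Maybe (Fin d)) → Dec (x ≡ y)
  _≟ᴹ_ = Maybe-≡-dec _≟_

  module _ {d : ℕ} (φ : PartialColoring d) where

    colorClass : Fin d → List (Edge d)
    colorClass c = filter (λ e → φ e ≟ᴹ just c) (allEdges d)

    module _ (π : Fin d → Fin d) where

      Conflict : Edge d → Set
      Conflict e = φ e ≡ just (π (dir e))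

      conflict? : ∀ e → Dec (Conflict e)
      conflict? e = φ e ≟ᴹ just (π (dir e))

      conflicts : List (Edge d)
      conflicts = filter conflict? (allEdges d)

      -- The exchange gives the opposite edge the color `π j`. For `j ≡ dir e` the opposite edge is
      -- `e` itself, which at a conflict would always count as blocked and spoil the average.
      OppositeBlocked : Edge d → Fin d → Set
      OppositeBlocked e j = j ≢ dir e × φ (opposite e j) ≡ just (π j)

      oppositeBlocked? : ∀ e j → Dec (OppositeBlocked e j)
      oppositeBlocked? e j = ¬? (j ≟ dir e) ×-dec φ (opposite e j) ≟ᴹ just (π j)

      blockedDirs : Edge d → List (Fin d)
      blockedDirs e = filter (oppositeBlocked? e) (allFin d)

  module Recoloring {d : ℕ} (φ : PartialColoring d) (π : Perm d) where

    private
      p     = proj₁ π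
      p-inj = proj₂ π

    -- The exchange gives `p j` to the opposite edge and `p (dir e)` to the two edges in direction
    -- `j`; `opposite-ok` and `color-ok` keep these clear of `φ`. `no-conflict` leaves every other
    -- conflict to its own square.
    record Resolves (s : Square d) : Set where
      private
        e = proj₁ s
        j = proj₂ s
      field
        conflict     : Conflict φ p e
        proper       : j ≢ dir e
        opposite-ok  : φ (opposite e j) ≢ just (p j)
        color-ok     : ∀ x → x ∈□ s → x ≢ e → φ x ≢ just (p (dir e))
        no-conflict  : ∀ x → x ∈□ s → x ≢ e → ¬ Conflict φ p x

    Disjoint : List (Square d) → Set
    Disjoint L = ∀ {s t} → s ∈ L → t ∈ L → ∀ x → x ∈□ s → x ∈□ t → s ≡ t

    recolor : List (Square d) → Edge d → Fin d
    recolor L x with anyᴸ? (x ∈□?_) L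
    ... | yes x∈ = p (swap (proj₁ (find x∈)) (dir x))
    ... | no  _  = p (dir x)

    recolor-cases : ∀ L x →
      (∃ λ s → s ∈ L × x ∈□ s × recolor L x ≡ p (swap s (dir x))) ⊎
      ((∀ {s} → s ∈ L → ¬ (x ∈□ s)) × recolor L x ≡ p (dir x))
    recolor-cases L x with anyᴸ? (x ∈□?_) L
    ... | yes x∈ = let s , s∈ , x∈s = find x∈ in inj₁ (s , s∈ , x∈s , refl)
    ... | no  x∉ = inj₂ ((λ s∈ x∈s → x∉ (lose s∈ x∈s)) , refl)

    -- As `p` is injective, equal colors at a common vertex `v` mean equal directions after the
    -- exchange. A square has edges in both of its directions at each of its vertices, so the edge
    -- at `v` in this new direction stays on the square.
    recolor-proper : ∀ L → (∀ {s} → s ∈ L → Resolves s) → Disjoint L → ProperColoring (recolor L)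
    recolor-proper L resolves disjoint x y (x≢y , v , vx , vy) fx≡fy
      with recolor-cases L x | recolor-cases L y
    ... | inj₂ (_ , fx) | inj₂ (_ , fy) = x≢y (incident-unique v x y (endpoint⇒incident {e = x} vx)
            (endpoint⇒incident {e = y} vy) (p-inj (trans (sym fx) (trans fx≡fy fy))))
    -- Here `y` keeps its direction, so it is the edge of `s` at `v` in that direction, although it
    -- lies on no chosen square.
    ... | inj₁ (s , s∈ , x∈s , fx) | inj₂ (y∉ , fy) = y∉ s∈ (agreesOff⇒∈□ v y s (endpoint⇒incident {e = y} vy)
            (subst (Spans s) (p-inj (trans (sym fx) (trans fx≡fy fy))) (swap-spans s (dir x)))
            (∈□⇒agreesOff v x s (endpoint⇒incident {e = x} vx) x∈s))
    ... | inj₂ (x∉ , fx) | inj₁ (t , t∈ , y∈t , fy) = x∉ t∈ (agreesOff⇒∈□ v x t (endpoint⇒incident {e = x} vx)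
            (subst (Spans t) (p-inj (trans (sym fy) (trans (sym fx≡fy) fx))) (swap-spans t (dir y)))
            (∈□⇒agreesOff v y t (endpoint⇒incident {e = y} vy) y∈t))
    -- The edge at `v` in the common new direction lies on both squares, so disjointness identifies
    -- them and injectivity of `swap` finishes.
    ... | inj₁ (s , s∈ , x∈s , fx) | inj₁ (t , t∈ , y∈t , fy) with disjoint s∈ t∈ (edgeAt v k) z∈s z∈t
      where
      k = swap s (dir x)
      k≡ : k ≡ swap t (dir y)
      k≡ = p-inj (trans (sym fx) (trans fx≡fy fy))
      z∈s : edgeAt v k ∈□ s
      z∈s = agreesOff⇒∈□ v (edgeAt v k) s (edgeAt-incident v k) (swap-spans s (dir x))
              (∈□⇒agreesOff v x s (endpoint⇒incident {e = x} vx) x∈s)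
      z∈t : edgeAt v k ∈□ t
      z∈t = agreesOff⇒∈□ v (edgeAt v k) t (edgeAt-incident v k)
              (subst (Spans t) (sym k≡) (swap-spans t (dir y)))
              (∈□⇒agreesOff v y t (endpoint⇒incident {e = y} vy) y∈t)
    ... | refl = x≢y (incident-unique v x y (endpoint⇒incident {e = x} vx) (endpoint⇒incident {e = y} vy)
            (swap-injective (proj₁ s) (proj₂ s) (Resolves.proper (resolves s∈)) (proj₁ x∈s) (proj₁ y∈t)
              (p-inj (trans (sym fx) (trans fx≡fy fy)))))

    -- Off the squares, a hit would be a conflict, and conflicts are covered. On a square, `e` moves
    -- away from its own `φ`-color, and the other three edges are guarded by `opposite-ok` and
    -- `color-ok`.
    recolor-avoids : ∀ L → (∀ {s} → s ∈ L → Resolves s) →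
      (∀ {e} → Conflict φ p e → ∃ λ j → (e , j) ∈ L) →
      ∀ x c → φ x ≡ just c → recolor L x ≢ c
    recolor-avoids L resolves covers x c φx≡c fx≡c with recolor-cases L x
    ... | inj₂ (x∉ , fx) =
      let j , s∈ = covers (trans φx≡c (cong just (trans (sym fx≡c) fx))) in x∉ s∈ (e∈□ x j)
    ... | inj₁ (s@(e , j) , s∈ , x∈s , fx) with x ≟ᴱ e
    ...   | yes refl = proper (p-inj (trans (sym (trans fx (cong p (swap-dir e j refl))))
                         (trans fx≡c (just-injective (trans (sym φx≡c) conflict)))))
      where open Resolves (resolves s∈)
    ...   | no x≢e with dir x ≟ dir e
    ...     | yes dir≡ = opposite-ok (subst (λ y → φ y ≡ just (p j)) (∈□-sameDir x∈s x≢e dir≡)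
                           (trans φx≡c (cong just (trans (sym fx≡c) fx))))
      where open Resolves (resolves s∈)
    ...     | no  dir≢ = color-ok x x∈s x≢e
                           (trans φx≡c (cong just (trans (sym fx≡c) fx)))
      where open Resolves (resolves s∈)

    -- Invariant of the greedy choice: `size` bounds the edges already used, and `within` shows that
    -- a new conflict is not the one resolved by an earlier square.
    record Resolution (ks : List (Edge d)) : Set where
      field
        squares  : List (Square d)
        resolves : ∀ {s} → s ∈ squares → Resolves s
        within   : ∀ {s} → s ∈ squares → proj₁ s ∈ ks
        covers   : ∀ {e} → e ∈ ks → ∃ λ j → (e , j) ∈ squares
        disjoint : Disjoint squares
        size     : length squares ≡ length ks

    length-concatMap-squareEdges : (L : List (Square d)) → length (concatMap squareEdges L) ≡ length L * 4
    length-concatMap-squareEdges []      = refl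
    length-concatMap-squareEdges (s ∷ L) = cong (4 +_) (length-concatMap-squareEdges L)

    -- The factor 5 combines one direction lost per conflict with four lost per earlier square.
    Room : Set
    Room = ∀ e → Conflict φ p e → length (blockedDirs φ p e) +
             (5 * length (conflicts φ p) + length (colorClass φ (p (dir e)))) < d

    module Step {ks : List (Edge d)} (R : Resolution ks) (e : Edge d)
                (e∉ks : All.All (e ≢_) ks) (conf : Conflict φ p e) where
      open Resolution R

      class : List (Edge d)
      class = colorClass φ (p (dir e))

      avoided : List (Edge d)
      avoided = conflicts φ p ++ concatMap squareEdges squares ++ class

      -- By `squareDir-unique`, each avoided edge other than `e` spoils at most one direction, so
      -- counting edges bounds the spoiled directions.
      forbidden : List (Fin d)
      forbidden = blockedDirs φ p e ++ map (squareDir e) avoided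

      length-avoided : length ks ≤ length (conflicts φ p) →
                       length avoided ≤ 5 * length (conflicts φ p) + length class
      length-avoided size≤ = begin
        length avoided
          ≡⟨ length-++ (conflicts φ p) ⟩
        X + length (concatMap squareEdges squares ++ class)
          ≡⟨ cong (X +_) (length-++ (concatMap squareEdges squares)) ⟩
        X + (length (concatMap squareEdges squares) + length class)
          ≡⟨ cong (λ l → X + (l + length class)) (length-concatMap-squareEdges squares) ⟩
        X + (length squares * 4 + length class)
          -- Bounding the number of earlier squares by the number of all conflicts makes the
          -- estimate uniform over the stages.
          ≤⟨ +-monoʳ-≤ X (+-monoˡ-≤ (length class) (*-monoˡ-≤ 4 (≤-trans (≤-reflexive size) size≤))) ⟩
        X + (X * 4 + length class)
          ≡⟨ solve 2 (λ x c → x :+ (x :* con 4 :+ c) := con 5 :* x :+ c) refl X (length class) ⟩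
        5 * X + length class ∎
        where
        open +-*-Solver
        X = length (conflicts φ p)

      length-forbidden : Room → length ks ≤ length (conflicts φ p) → length forbidden < d
      length-forbidden room size≤ = begin-strict
        length forbidden
          ≡⟨ length-++ (blockedDirs φ p e) ⟩
        length (blockedDirs φ p e) + length (map (squareDir e) avoided)
          ≡⟨ cong (length (blockedDirs φ p e) +_) (length-map (squareDir e) avoided) ⟩
        length (blockedDirs φ p e) + length avoided
          ≤⟨ +-monoʳ-≤ (length (blockedDirs φ p e)) (length-avoided size≤) ⟩
        length (blockedDirs φ p e) + (5 * length (conflicts φ p) + length class)
          <⟨ room e conf ⟩
        d ∎

      module _ (j : Fin d) (j∉ : j ∉ forbidden) where

        not-avoided : ∀ {x} → x ∈□ (e , j) → x ≢ e → x ∉ avoided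
        not-avoided x∈s x≢e x∈ = j∉ (∈-++⁺ʳ (blockedDirs φ p e)
          (subst (_∈ map (squareDir e) avoided) (squareDir-unique x∈s x≢e) (∈-map⁺ (squareDir e) x∈)))

        conflict⇒avoided : ∀ {x} → Conflict φ p x → x ∈ avoided
        conflict⇒avoided {x} cx = ∈-++⁺ˡ (∈-filter⁺ (conflict? φ p) (∈-allEdges x) cx)

        j≢dir : j ≢ dir e
        j≢dir j≡ = j∉ (∈-++⁺ʳ (blockedDirs φ p e) (subst (_∈ map (squareDir e) avoided)
          (trans (squareDir-self e) (sym j≡)) (∈-map⁺ (squareDir e) (conflict⇒avoided conf))))

        new-resolves : Resolves (e , j)
        new-resolves = record
          { conflict    = conf
          ; proper      = j≢dir
          ; opposite-ok = λ eq → j∉ (∈-++⁺ˡ (∈-filter⁺ (oppositeBlocked? φ p e) (∈-allFin j) (j≢dir , eq)))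
          ; color-ok    = λ x x∈s x≢e eq → not-avoided x∈s x≢e (∈-++⁺ʳ (conflicts φ p)
              (∈-++⁺ʳ (concatMap squareEdges squares)
                (∈-filter⁺ (λ y → φ y ≟ᴹ just (p (dir e))) (∈-allEdges x) eq)))
          ; no-conflict = λ x x∈s x≢e cx → not-avoided x∈s x≢e (conflict⇒avoided cx)
          }

        -- A shared edge `e` would be a foreign conflict on the earlier square, against
        -- `no-conflict`. Any other shared edge is listed in `avoided`.
        new-disjoint : ∀ {t} → t ∈ squares → ∀ x → x ∈□ (e , j) → ¬ (x ∈□ t)
        new-disjoint {t} t∈ x x∈s x∈t with x ≟ᴱ e
        ... | yes refl = Resolves.no-conflict (resolves t∈) e x∈t (All.lookup e∉ks (within t∈)) conf
        ... | no  x≢e  = not-avoided x∈s x≢e (∈-++⁺ʳ (conflicts φ p)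
                           (∈-++⁺ˡ (∈-concatMap⁺ squareEdges (lose t∈ (∈□⇒∈squareEdges x t x∈t)))))

        extended-disjoint : Disjoint ((e , j) ∷ squares)
        extended-disjoint (here refl) (here refl) x _   _   = refl
        extended-disjoint (here refl) (there t∈)  x x∈s x∈t = contradiction x∈t (new-disjoint t∈ x x∈s)
        extended-disjoint (there s∈)  (here refl) x x∈s x∈t = contradiction x∈s (new-disjoint s∈ x x∈t)
        extended-disjoint (there s∈)  (there t∈)  x x∈s x∈t = disjoint s∈ t∈ x x∈s x∈t

        extended : Resolution (e ∷ ks)
        extended = record
          { squares  = (e , j) ∷ squares
          ; resolves = λ { (here refl) → new-resolves ; (there s∈) → resolves s∈ }
          ; within   = λ { (here refl) → here refl ; (there s∈) → there (within s∈) }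
          ; covers   = λ { (here refl) → j , here refl
                         ; (there k∈)  → let j′ , s∈ = covers k∈ in j′ , there s∈ }
          ; disjoint = extended-disjoint
          ; size     = cong suc size
          }

    resolve : Room → ∀ ks → Unique ks → (∀ {e} → e ∈ ks → Conflict φ p e) →
              length ks ≤ length (conflicts φ p) → Resolution ks
    resolve room [] _ _ _ = record
      { squares = [] ; resolves = λ () ; within = λ () ; covers = λ () ; disjoint = λ () ; size = refl }
    resolve room (e ∷ ks) (e∉ks ∷ ks-unique) conf size≤ =
      let j , j∉ = ∃-∉ forbidden (length-forbidden room size≤′) in extended j j∉
      where
      size≤′ = ≤-trans (n≤1+n _) size≤
      open Step (resolve room ks ks-unique (conf ∘ there) size≤′) e e∉ks (conf (here refl))

    room⇒avoidable : Room → Avoidable φ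
    room⇒avoidable room = recolor squares , recolor-proper squares resolves disjoint ,
      recolor-avoids squares resolves (λ {e} ce → covers (∈-filter⁺ (conflict? φ p) (∈-allEdges e) ce))
      where
      open Resolution (resolve room (conflicts φ p) (filter⁺ (conflict? φ p) (allEdges-unique d))
                        (λ e∈ → proj₂ (∈-filter⁻ (conflict? φ p) {xs = allEdges d} e∈)) ≤-refl)

  -- Choice of the permutation

  conflict-zero : ∀ {d} (φ : PartialColoring d) π e → φ e ≡ nothing → 𝟙 (conflict? φ π e) ≡ 0
  conflict-zero φ π e eq = 𝟙-no (conflict? φ π e) (λ ce → contradiction (trans (sym eq) ce) λ ())

  conflict-≤ : ∀ {d} (φ : PartialColoring d) π e {c} → φ e ≡ just c → 𝟙 (conflict? φ π e) ≤ 𝟙 (π (dir e) ≟ c)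
  conflict-≤ φ π e {c} eq = 𝟙-mono (conflict? φ π e) (π (dir e) ≟ c) (λ ce → just-injective (trans (sym ce) eq))

  -- A colored edge is a conflict exactly when the permutation sends its direction to its color,
  -- which happens with probability `1 / suc n`.
  ∑-conflict : ∀ {n} (φ : PartialColoring (suc n)) e → ∑[ π ∈ perms (suc n) ] 𝟙 (conflict? φ (proj₁ π) e) ≤ n !
  ∑-conflict {n} φ e = go (φ e) refl
    where
    go : ∀ c → φ e ≡ c → ∑[ π ∈ perms (suc n) ] 𝟙 (conflict? φ (proj₁ π) e) ≤ n !
    go nothing  eq = ≤-trans (≤-reflexive (∑-zero (perms (suc n)) (λ π → conflict-zero φ (proj₁ π) e eq))) z≤n
    go (just c) eq = ≤-trans (∑-mono (perms (suc n)) (λ π → conflict-≤ φ (proj₁ π) e eq))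
                             (∑-perms-fixed n (dir e) c)

  blockedTotal : ∀ {d} → PartialColoring d → Edge d → Fin d → ℕ
  blockedTotal {d} φ e j =
    ∑[ π ∈ perms d ] (𝟙 (conflict? φ (proj₁ π) e) * 𝟙 (oppositeBlocked? φ (proj₁ π) e j))

  -- Both events together prescribe the permutation at the distinct positions `dir e` and `j`.
  blockedTotal-≤ : ∀ {n} (φ : PartialColoring (2 + n)) e j → j ≢ dir e → blockedTotal φ e j ≤ n !
  blockedTotal-≤ {n} φ e j j≢ = go (φ e) refl (φ (opposite e j)) refl
    where
    go : ∀ c → φ e ≡ c → ∀ c′ → φ (opposite e j) ≡ c′ → blockedTotal φ e j ≤ n !
    go nothing eq _ _ = ≤-trans (≤-reflexive (∑-zero (perms (2 + n))
      (λ π → cong (_* 𝟙 (oppositeBlocked? φ (proj₁ π) e j)) (conflict-zero φ (proj₁ π) e eq)))) z≤n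
    go (just c) _ nothing eq′ = ≤-trans (≤-reflexive (∑-zero (perms (2 + n)) (λ π →
      trans (cong (𝟙 (conflict? φ (proj₁ π) e) *_) (𝟙-no (oppositeBlocked? φ (proj₁ π) e j)
              (λ (_ , b) → contradiction (trans (sym eq′) b) λ ())))
            (*-zeroʳ (𝟙 (conflict? φ (proj₁ π) e)))))) z≤n
    go (just c) eq (just c′) eq′ = ≤-trans
      (∑-mono (perms (2 + n)) (λ π → *-mono-≤ (conflict-≤ φ (proj₁ π) e eq)
        (𝟙-mono (oppositeBlocked? φ (proj₁ π) e j) (proj₁ π j ≟ c′)
          (λ (_ , b) → just-injective (trans (sym b) eq′)))))
      (∑-perms-fixed₂ n (dir e) j c c′ (j≢ ∘ sym))

  blockedTotal-dir : ∀ {d} (φ : PartialColoring d) e → blockedTotal φ e (dir e) ≡ 0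
  blockedTotal-dir {d} φ e = ∑-zero (perms d) (λ π →
    trans (cong (𝟙 (conflict? φ (proj₁ π) e) *_)
            (𝟙-no (oppositeBlocked? φ (proj₁ π) e (dir e)) (λ (dir≢ , _) → dir≢ refl)))
          (*-zeroʳ (𝟙 (conflict? φ (proj₁ π) e))))

  -- In dimension `2 + n` there are `suc n` directions besides `dir e`, each contributing at most
  -- `n !`.
  ∑-blockedTotal : ∀ n (φ : PartialColoring (suc n)) e → ∑ (allFin (suc n)) (blockedTotal φ e) ≤ n !
  -- In dimension 1 the sole direction is `dir e`, so the pointwise bound holds vacuously.
  ∑-blockedTotal zero φ e = ≤-trans (m≤m+n _ 1)
    (∑-omit (blockedTotal φ e) 1 (dir e) (blockedTotal-dir φ e)
      (λ j j≢ → contradiction (Fin1-unique j (dir e)) j≢))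
    where
    Fin1-unique : (i j : Fin 1) → i ≡ j
    Fin1-unique zero zero = refl
  ∑-blockedTotal (suc n) φ e = +-cancelʳ-≤ (n !) _ _ (≤-trans
    (∑-omit (blockedTotal φ e) (n !) (dir e) (blockedTotal-dir φ e) (blockedTotal-≤ φ e))
    (≤-reflexive (+-comm (n !) (suc n * n !))))

  module _ {n : ℕ} (φ : PartialColoring (suc n)) where

    private
      D  = suc n
      Πs = perms D

    -- The contribution of `e` to `Y`; the first factor restricts the count to conflicts.
    blockedCount : (Fin D → Fin D) → Edge D → ℕ
    blockedCount π e = 𝟙 (conflict? φ π e) * length (blockedDirs φ π e)

    ∑-blockedCount : ∀ e → ∑[ π ∈ Πs ] blockedCount (proj₁ π) e ≤ n !
    ∑-blockedCount e = begin
      ∑[ π ∈ Πs ] blockedCount (proj₁ π) e    ≤⟨ ∑-mono Πs (λ π → ≤-reflexive (expand (proj₁ π))) ⟩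
      ∑[ π ∈ Πs ] ∑[ j ∈ allFin D ] term (proj₁ π) j ≡⟨ ∑-swap Πs (allFin D) (term ∘ proj₁) ⟩
      ∑ (allFin D) (blockedTotal φ e)         ≤⟨ ∑-blockedTotal n φ e ⟩
      n !                                     ∎
      where
      term : (Fin D → Fin D) → Fin D → ℕ
      term π j = 𝟙 (conflict? φ π e) * 𝟙 (oppositeBlocked? φ π e j)
      expand : ∀ π → blockedCount π e ≡ ∑[ j ∈ allFin D ] term π j
      expand π = trans (cong (𝟙 (conflict? φ π e) *_) (length-filter≡∑𝟙 (oppositeBlocked? φ π e) (allFin D)))
                       (sym (∑-*ˡ (allFin D) (𝟙 (conflict? φ π e)) _))

    -- Equal to 1 on colored edges and 0 elsewhere; written as a sum over colors so that exchanging
    -- sums brings in the class sizes.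
    colorIndicator : Edge D → ℕ
    colorIndicator e = ∑[ c ∈ allFin D ] 𝟙 (φ e ≟ᴹ just c)

    ∑-colorIndicator : ∀ {m} → (∀ c → length (colorClass φ c) ≤ m) → ∑ (allEdges D) colorIndicator ≤ D * m
    ∑-colorIndicator {m} class≤ = begin
      ∑[ e ∈ allEdges D ] ∑[ c ∈ allFin D ] 𝟙 (φ e ≟ᴹ just c)
        ≡⟨ ∑-swap (allEdges D) (allFin D) (λ e c → 𝟙 (φ e ≟ᴹ just c)) ⟩
      ∑[ c ∈ allFin D ] ∑[ e ∈ allEdges D ] 𝟙 (φ e ≟ᴹ just c)
        ≤⟨ ∑-mono (allFin D) (λ c → ≤-trans
             (≤-reflexive (sym (length-filter≡∑𝟙 (λ e → φ e ≟ᴹ just c) (allEdges D)))) (class≤ c)) ⟩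
      ∑[ _ ∈ allFin D ] m
        ≡⟨ ∑-allFin-const D m ⟩
      D * m ∎

    cost : (Fin D → Fin D) → Edge D → ℕ
    cost π e = 5 * 𝟙 (conflict? φ π e) + blockedCount π e

    -- A colored edge costs at most `5 * n !` for conflicts and `n !` for blocked directions; an
    -- uncolored one is never a conflict and costs nothing.
    ∑-cost : ∀ e → ∑[ π ∈ Πs ] cost (proj₁ π) e ≤ colorIndicator e * (6 * n !)
    ∑-cost e = go (φ e) refl
      where
      go : ∀ c → φ e ≡ c → ∑[ π ∈ Πs ] cost (proj₁ π) e ≤ colorIndicator e * (6 * n !)
      go nothing eq = ≤-trans (≤-reflexive (∑-zero Πs (λ π →
        cong (λ h → 5 * h + h * length (blockedDirs φ (proj₁ π) e)) (conflict-zero φ (proj₁ π) e eq)))) z≤n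
      go (just c) eq = begin
        ∑[ π ∈ Πs ] cost (proj₁ π) e
          ≡⟨ ∑-+ Πs _ _ ⟩
        ∑[ π ∈ Πs ] (5 * 𝟙 (conflict? φ (proj₁ π) e)) + ∑[ π ∈ Πs ] blockedCount (proj₁ π) e
          ≡⟨ cong (_+ ∑[ π ∈ Πs ] blockedCount (proj₁ π) e) (∑-*ˡ Πs 5 _) ⟩
        5 * ∑[ π ∈ Πs ] 𝟙 (conflict? φ (proj₁ π) e) + ∑[ π ∈ Πs ] blockedCount (proj₁ π) e
          ≤⟨ +-mono-≤ (*-monoʳ-≤ 5 (∑-conflict φ e)) (∑-blockedCount e) ⟩
        5 * n ! + n !
          ≡⟨ solve 1 (λ x → con 5 :* x :+ x := con 1 :* (con 6 :* x)) refl (n !) ⟩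
        1 * (6 * n !)
          ≤⟨ *-monoˡ-≤ (6 * n !) (≤-trans (≤-reflexive (sym (𝟙-yes (φ e ≟ᴹ just c) eq)))
               (∈⇒≤∑ (λ c → 𝟙 (φ e ≟ᴹ just c)) (∈-allFin c))) ⟩
        colorIndicator e * (6 * n !) ∎
        where open +-*-Solver

    -- The total over all permutations is at most `D * m * (6 * n !)`, which is `D !` times `6 * m`,
    -- so some permutation does no worse than `6 * m`.
    ∃-cheap : ∀ {m} → (∀ c → length (colorClass φ c) ≤ m) →
              ∃ λ (π : Perm D) → ∑ (allEdges D) (cost (proj₁ π)) ≤ 6 * m
    ∃-cheap {m} class≤ = ∃-≤average Πs (λ π → ∑ (allEdges D) (cost (proj₁ π))) (6 * m)
      (subst (0 <_) (sym (length-perms D)) (1≤n! D)) (begin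
      ∑[ π ∈ Πs ] ∑[ e ∈ allEdges D ] cost (proj₁ π) e   ≡⟨ ∑-swap Πs (allEdges D) (cost ∘ proj₁) ⟩
      ∑[ e ∈ allEdges D ] ∑[ π ∈ Πs ] cost (proj₁ π) e   ≤⟨ ∑-mono (allEdges D) ∑-cost ⟩
      ∑[ e ∈ allEdges D ] (colorIndicator e * (6 * n !)) ≡⟨ ∑-*ʳ (allEdges D) colorIndicator (6 * n !) ⟩
      ∑ (allEdges D) colorIndicator * (6 * n !)          ≤⟨ *-monoˡ-≤ (6 * n !) (∑-colorIndicator class≤) ⟩
      D * m * (6 * n !)
        ≡⟨ solve 3 (λ a b c → a :* b :* (con 6 :* c) := a :* c :* (con 6 :* b)) refl D m (n !) ⟩
      D * n ! * (6 * m)                                  ≡⟨ cong (_* (6 * m)) (length-perms D) ⟨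
      length Πs * (6 * m)                                ∎)
      where open +-*-Solver

    smallClasses⇒avoidable : ∀ m → 8 * m ≤ D → (∀ c → length (colorClass φ c) ≤ m) → Avoidable φ
    smallClasses⇒avoidable m 8m≤D class≤ with ∃-cheap class≤
    ... | perm@(π , _) , cheap = Recoloring.room⇒avoidable φ perm λ e ce → begin-strict
      length (blockedDirs φ π e) + (5 * length (conflicts φ π) + length (colorClass φ (π (dir e))))
        ≡⟨ solve 3 (λ y x c → y :+ (x :+ c) := x :+ y :+ c) refl
             (length (blockedDirs φ π e)) (5 * length (conflicts φ π)) (length (colorClass φ (π (dir e)))) ⟩
      5 * length (conflicts φ π) + length (blockedDirs φ π e) + length (colorClass φ (π (dir e)))
        ≤⟨ +-mono-≤ (+-mono-≤ (≤-reflexive (cong (5 *_) (length-filter≡∑𝟙 (conflict? φ π) (allEdges D))))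
                              (blocked≤ e ce))
                    (class≤ (π (dir e))) ⟩
      5 * ∑ (allEdges D) (𝟙 ∘ conflict? φ π) + ∑ (allEdges D) (blockedCount π) + m
        ≡⟨ cong (_+ m) (trans (∑-+ (allEdges D) _ _)
             (cong (_+ ∑ (allEdges D) (blockedCount π)) (∑-*ˡ (allEdges D) 5 _))) ⟨
      ∑ (allEdges D) (cost π) + m  ≤⟨ +-monoˡ-≤ m cheap ⟩
      6 * m + m                    ≡⟨ solve 1 (λ m → con 6 :* m :+ m := con 7 :* m) refl m ⟩
      7 * m                        <⟨ 7m<D m 8m≤D ⟩
      D                            ∎
      where
      open +-*-Solver
      -- Strictness comes from `m > 0`, or for `m = 0` from the positive dimension.
      7m<D : ∀ m → 8 * m ≤ D → 7 * m < D
      7m<D zero    _    = s≤s z≤n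
      7m<D (suc m) 8m≤D = <-≤-trans (*-monoˡ-< (suc m) {7} {8} ≤-refl) 8m≤D
      -- At a conflict, the blocked directions form a single term of `Y`.
      blocked≤ : ∀ e → Conflict φ π e → length (blockedDirs φ π e) ≤ ∑ (allEdges D) (blockedCount π)
      blocked≤ e ce = ≤-trans
        (≤-reflexive (sym (trans (cong (_* length (blockedDirs φ π e)) (𝟙-yes (conflict? φ π e) ce))
                                 (*-identityˡ _))))
        (∈⇒≤∑ (blockedCount π) (∈-allEdges e))

open import Defs
open import Data.Nat using (ℕ; _≤_)
open import Data.Fin using (Fin)
open import Data.Maybe using (just)
open import Data.Integer using (+_)
open import Data.Rational using (ℚ; _/_; _+_; _-_; _*_; 0ℚ; 1ℚ) renaming (_≤_ to _≤ℚ_)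
open import Data.Product using (_×_)
open import Relation.Binary.PropositionalEquality using (_≡_)

import Data.Nat as ℕ
import Data.Nat.Properties as ℕ
import Data.Nat.DivMod as ℕ
import Data.Integer as ℤ
import Data.Integer.Properties as ℤ
import Data.Rational.Unnormalised as ℚᵘ
import Data.Rational.Unnormalised.Properties as ℚᵘ
open import Data.List using (length)
open import Data.List.Relation.Unary.All.Properties using (all-filter)
open import Data.List.Relation.Unary.Unique.Propositional.Properties using (filter⁺)
open import Data.Product using (_,_)
open import Data.Rational using (*≤*; 1/_; toℚᵘ; NonZero; NonNegative; Positive; nonNegative)
open import Data.Rational.Properties
open import Relation.Binary.PropositionalEquality using (cong; subst; subst₂)
open Combinatorics using (colorClass; _≟ᴹ_; allEdges; allEdges-unique; smallClasses⇒avoidable)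

-- From rational bounds to natural numbers, and the theorem

toℚᵘ-ℕ→ℚ : ∀ n → toℚᵘ (ℕ→ℚ n) ℚᵘ.≃ ℚᵘ.mkℚᵘ (+ n) 0
toℚᵘ-ℕ→ℚ n = toℚᵘ-fromℚᵘ (ℚᵘ.mkℚᵘ (+ n) 0)

-- Normalisation by a gcd blocks computation on variables; in the unnormalised rationals the
-- numerators multiply directly.
ℕ→ℚ-* : ∀ m n → ℕ→ℚ (m ℕ.* n) ≡ ℕ→ℚ m * ℕ→ℚ n
ℕ→ℚ-* m n = toℚᵘ-injective (begin-equality
  toℚᵘ (ℕ→ℚ (m ℕ.* n))                   ≃⟨ toℚᵘ-ℕ→ℚ (m ℕ.* n) ⟩
  ℚᵘ.mkℚᵘ (+ (m ℕ.* n)) 0                ≡⟨ cong (λ k → ℚᵘ.mkℚᵘ k 0) (ℤ.pos-* m n) ⟩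
  ℚᵘ.mkℚᵘ (+ m) 0 ℚᵘ.* ℚᵘ.mkℚᵘ (+ n) 0    ≃⟨ ℚᵘ.*-cong (toℚᵘ-ℕ→ℚ m) (toℚᵘ-ℕ→ℚ n) ⟨
  toℚᵘ (ℕ→ℚ m) ℚᵘ.* toℚᵘ (ℕ→ℚ n)         ≃⟨ toℚᵘ-homo-* (ℕ→ℚ m) (ℕ→ℚ n) ⟨
  toℚᵘ (ℕ→ℚ m * ℕ→ℚ n)                   ∎)
  where open ℚᵘ.≤-Reasoning

ℕ→ℚ-cancel-≤ : ∀ {m n} → ℕ→ℚ m ≤ℚ ℕ→ℚ n → m ≤ n
ℕ→ℚ-cancel-≤ {m} {n} m≤n
  with ℚᵘ.≤-respˡ-≃ (toℚᵘ-ℕ→ℚ m) (ℚᵘ.≤-respʳ-≃ (toℚᵘ-ℕ→ℚ n) (toℚᵘ-mono-≤ m≤n))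
... | ℚᵘ.*≤* p = ℤ.drop‿+≤+ (subst₂ ℤ._≤_ (ℤ.*-identityʳ (+ m)) (ℤ.*-identityʳ (+ n)) p)

-- Multiply by `k` and use `8 ≤ k`. Part (i) takes `k = 8`, part (ii) takes `k = C₂ C₁`.
≤d÷k⇒*8≤d : ∀ n d (k : ℚ) .{{_ : Positive k}} .{{_ : NonZero k}} → ℕ→ℚ 8 ≤ℚ k →
            ℕ→ℚ n ≤ℚ ℕ→ℚ d * 1/ k → n ℕ.* 8 ≤ d
≤d÷k⇒*8≤d n d k 8≤k n≤d÷k = ℕ→ℚ-cancel-≤ (begin
  ℕ→ℚ (n ℕ.* 8)        ≡⟨ ℕ→ℚ-* n 8 ⟩
  ℕ→ℚ n * ℕ→ℚ 8        ≤⟨ *-monoˡ-≤-nonNeg (ℕ→ℚ n) {{normalize-nonNeg n 1}} 8≤k ⟩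
  ℕ→ℚ n * k            ≤⟨ *-monoʳ-≤-nonNeg k {{pos⇒nonNeg k}} n≤d÷k ⟩
  ℕ→ℚ d * 1/ k * k     ≡⟨ *-assoc (ℕ→ℚ d) (1/ k) k ⟩
  ℕ→ℚ d * (1/ k * k)   ≡⟨ cong (ℕ→ℚ d *_) (*-inverseˡ k) ⟩
  ℕ→ℚ d * 1ℚ           ≡⟨ *-identityʳ (ℕ→ℚ d) ⟩
  ℕ→ℚ d                ∎)
  where open ≤-Reasoning

-- `C₂` increases with its argument, so its value at 1 decides.
8≤C₂ : ∀ C₁ → 1ℚ ≤ℚ C₁ → ℕ→ℚ 8 ≤ℚ C₂ C₁
8≤C₂ C₁ 1≤C₁ = begin
  -- The value at 1 is 2 * 3 * 34 * 34 = 6936 = 8 + 6928.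
  ℕ→ℚ 8                                        ≤⟨ *≤* (ℤ.+≤+ (ℕ.m≤m+n 8 6928)) ⟩
  ℕ→ℚ 2 * 1ℚ * (1ℚ + ℕ→ℚ 2) * ℕ→ℚ (34 ℕ.* 34)
    ≤⟨ *-monoʳ-≤-nonNeg (ℕ→ℚ (34 ℕ.* 34)) (*-monoˡ-≤-nonNeg (ℕ→ℚ 2 * 1ℚ) (+-monoˡ-≤ (ℕ→ℚ 2) 1≤C₁)) ⟩
  ℕ→ℚ 2 * 1ℚ * (C₁ + ℕ→ℚ 2) * ℕ→ℚ (34 ℕ.* 34)
    ≤⟨ *-monoʳ-≤-nonNeg (ℕ→ℚ (34 ℕ.* 34)) (*-monoʳ-≤-nonNeg (C₁ + ℕ→ℚ 2) {{C₁+2-nonNeg}}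
         (*-monoˡ-≤-nonNeg (ℕ→ℚ 2) 1≤C₁)) ⟩
  C₂ C₁                                        ∎
  where
  open ≤-Reasoning
  C₁+2-nonNeg : NonNegative (C₁ + ℕ→ℚ 2)
  C₁+2-nonNeg = nonNegative (≤-trans (*≤* (ℤ.+≤+ ℕ.z≤n)) (+-monoˡ-≤ (ℕ→ℚ 2) 1≤C₁))

-- `AtMost` is applied to the duplicate-free list of a whole color class; its length is an integer,
-- so the bound may be rounded down to `d / 8`.
classes≤d/8⇒avoidable : ∀ {d} → 1 ≤ d → (φ : PartialColoring d) (k : ℚ) →
  (∀ n → ℕ→ℚ n ≤ℚ k → n ℕ.* 8 ≤ d) → (∀ c → AtMost (λ e → φ e ≡ just c) k) → Avoidable φ
classes≤d/8⇒avoidable {d@(ℕ.suc _)} (ℕ.s≤s _) φ k k≤d/8 class≤ = smallClasses⇒avoidable φ (d ℕ./ 8)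
  (subst (_≤ d) (ℕ.*-comm (d ℕ./ 8) 8) (ℕ.m/n*n≤m d 8))
  (λ c → subst (_≤ d ℕ./ 8) (ℕ.m*n/n≡m (length (colorClass φ c)) 8) (ℕ./-monoˡ-≤ 8
    (k≤d/8 (length (colorClass φ c)) (class≤ c (colorClass φ c)
      (filter⁺ (λ e → φ e ≟ᴹ just c) (allEdges-unique d))
      (all-filter (λ e → φ e ≟ᴹ just c) (allEdges d))))))

theorem3p6 : (d : ℕ) → 1 ≤ d → (φ : PartialColoring d) →
    ((a b : ℕ → ℚ) →
    0ℚ ≤ℚ ((+ 109 / 1776) * (ℕ→ℚ d * ℕ→ℚ d) - ℕ→ℚ 2 * b d * (a d - (+ 7 / 8) * ℕ→ℚ d)) →
    b d ≤ℚ a d →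
    ((c : Fin d) → AtMost (λ e → φ e ≡ just c) (ℕ→ℚ d * (+ 1 / 8))) →
    ((e : Edge d) → AtMost (λ e' → Parallel e e' × Colored φ e') (b d)) →
    ((i : Fin d) → AtMost (λ e → dir e ≡ i × Colored φ e) (a d)) →
    Avoidable φ)
    ×
    ((C₁ : ℚ) → (h : 1ℚ ≤ℚ C₁) →
    ((i : Fin d) → AtMost (λ e → dir e ≡ i × Colored φ e) (C₁ * ℕ→ℚ d)) →
    ((c : Fin d) → AtMost (λ e → φ e ≡ just c) (d/C₂ d C₁ h)) →
    Avoidable φ)
theorem3p6 d 1≤d φ =
  (λ a b _ _ class≤ _ _ → classes≤d/8⇒avoidable 1≤d φ (ℕ→ℚ d * (+ 1 / 8))
    -- `+ 1 / 8` and the inverse of `ℕ→ℚ 8` agree by computation.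
    (λ n → ≤d÷k⇒*8≤d n d (ℕ→ℚ 8) ≤-refl) class≤) ,
  (λ C₁ h _ class≤ → classes≤d/8⇒avoidable 1≤d φ (d/C₂ d C₁ h)
    (λ n → ≤d÷k⇒*8≤d n d (C₂ C₁) {{C₂-pos C₁ h}} {{pos⇒nonZero (C₂ C₁) {{C₂-pos C₁ h}}}} (8≤C₂ C₁ h))
    class≤)
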